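{- Let $D$ be a positive integer. If $G$ is a 2-degenerate graph with $\Delta(G)\le D$, then $\omega(G^2)\le \frac52 D+72$. Furthermore, if $D\ge 1729$, then $\omega(G^2)\le \frac52 D+60$.
   Context: A graph is $k$-degenerate if every subgraph has a vertex of degree at most $k$ (equivalently, there is an ordering of its vertices in which each vertex has at most $k$ neighbors later in the order). The square $G^2$ of a graph $G$ is obtained from $G$ by adding an edge between every pair of vertices at distance 2 in $G$. $\omega(\cdot)$ denotes clique number and $\Delta(\cdot)$ maximum degree. -}

module Defs where

open import Data.Fin.Base using (Fin)
open import Data.Fin.Properties using (_≟_; any?; all?)
open import Data.Fin.Subset using (Subset; inside; outside; _∈_; Nonempty; ∣_∣)
open import Data.Fin.Subset.Properties using (_∈?_)
open import Data.List.Base using (List; []; _∷_; _++_; map; filter; allFin)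
open import Data.List.Extrema.Nat using (max)
open import Data.Nat.Base using (ℕ; zero; suc; _≤_; _<_; z≤n; s≤s)
open import Data.Nat.Properties using (allUpTo?)
open import Data.Product.Base using (∃; _×_; _,_)
open import Data.Sum.Base using (_⊎_; inj₁; inj₂)
open import Data.Vec.Base using ([]; _∷_; tabulate)
open import Level using (0ℓ)
open import Relation.Binary.Core using (Rel)
open import Relation.Binary.Definitions using (Decidable; Symmetric; Irreflexive)
open import Relation.Binary.PropositionalEquality.Core using (_≡_; _≢_; refl; sym)
open import Relation.Nullary.Decidable.Core
  using (Dec; does; _×-dec_; _⊎-dec_; _→-dec_; ¬?)
open import Relation.Nullary.Negation.Core using (¬_)

-- Finite simple graphs with vertex set Fin n.
record Graph (n : ℕ) : Set₁ where
  field
    Adj        : Rel (Fin n) 0ℓ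
    adj?       : Decidable Adj
    adj-sym    : Symmetric Adj
    adj-irrefl : Irreflexive _≡_ Adj

open Graph public

module _ {n : ℕ} (G : Graph n) where

  neighbours : Fin n → Subset n
  neighbours v = tabulate λ w → does (adj? G v w)

  degree : Fin n → ℕ
  degree v = ∣ neighbours v ∣

  -- The graph without vertices has maximum degree 0.
  Δ : ℕ
  Δ = max 0 (map degree (allFin n))

-- The edges of a subgraph are stored as a graph on all of Fin n whose edges
-- have both ends in the vertex set of the subgraph; a vertex of the subgraph
-- therefore has the same degree in edges as in the subgraph.
record Subgraph {n : ℕ} (G : Graph n) : Set₁ where
  field
    vertices : Subset n
    edges    : Graph n
    edges⊆   : ∀ {u v} → Adj edges u v → Adj G u v
    ends     : ∀ {u v} → Adj edges u v → u ∈ vertices × v ∈ vertices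

open Subgraph public

-- As usual, only subgraphs with at least one vertex are considered.
Degenerate : ∀ {n} → ℕ → Graph n → Set₁
Degenerate k G = (H : Subgraph G) → Nonempty (vertices H) →
  ∃ λ v → v ∈ vertices H × degree (edges H) v ≤ k

module _ {n : ℕ} (G : Graph n) where

  Walk : ℕ → Rel (Fin n) 0ℓ
  Walk zero    u v = u ≡ v
  Walk (suc k) u v = ∃ λ w → Adj G u w × Walk k w v

  AtDistance : ℕ → Rel (Fin n) 0ℓ
  AtDistance k u v = Walk k u v × (∀ {j} → j < k → ¬ Walk j u v)

  walk? : ∀ k → Decidable (Walk k)
  walk? zero    u v = u ≟ v
  walk? (suc k) u v = any? λ w → adj? G u w ×-dec walk? k w v

  atDistance? : ∀ k → Decidable (AtDistance k)
  atDistance? k u v =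
    walk? k u v ×-dec allUpTo? (λ j → ¬? (walk? j u v)) k

  snoc : ∀ k {u v w} → Walk k u v → Adj G v w → Walk (suc k) u w
  snoc zero    refl        b = _ , b , refl
  snoc (suc k) (x , a , p) b = x , a , snoc k p b

  reverse : ∀ k → Symmetric (Walk k)
  reverse zero    eq          = sym eq
  reverse (suc k) (w , a , p) = snoc k (reverse k p) (adj-sym G a)

  atDistance-sym : ∀ k → Symmetric (AtDistance k)
  atDistance-sym k (p , min) =
    reverse k p , λ {j} j<k q → min j<k (reverse j q)

infix 8 _²

_² : ∀ {n} → Graph n → Graph n
(G ²) .Adj u v = Adj G u v ⊎ AtDistance G 2 u v
(G ²) .adj? u v = adj? G u v ⊎-dec atDistance? G 2 u v
(G ²) .adj-sym (inj₁ a) = inj₁ (adj-sym G a)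
(G ²) .adj-sym (inj₂ d) = inj₂ (atDistance-sym G 2 d)
(G ²) .adj-irrefl eq (inj₁ a) = adj-irrefl G eq a
(G ²) .adj-irrefl eq (inj₂ (_ , min)) = min (s≤s z≤n) eq

subsets : ∀ n → List (Subset n)
subsets zero    = [] ∷ []
subsets (suc n) = map (outside ∷_) (subsets n) ++ map (inside ∷_) (subsets n)

module _ {n : ℕ} (G : Graph n) where

  Clique : Subset n → Set
  Clique S = ∀ u v → u ∈ S → v ∈ S → u ≢ v → Adj G u v

  clique? : ∀ S → Dec (Clique S)
  clique? S = all? λ u → all? λ v →
    (u ∈? S) →-dec ((v ∈? S) →-dec (¬? (u ≟ v) →-dec adj? G u v))

  ω : ℕ
  ω = max 0 (map ∣_∣ (filter clique? (subsets n)))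

module Submission where

-- Orient every edge of G along a degeneracy order, so that out-degrees are at
-- most 2, and let S be a clique of G². Two members of S are joined by an arc,
-- by a directed path of length 2, by a common in-neighbour or by a common
-- out-neighbour. A member v is adjacent to at most 6 vertices through arcs and
-- paths leaving v, and to at most D through common in-neighbours. So if no arc
-- or path from S ends in v, at least |S| - 7 - D members share an out-neighbour
-- with v; the first member in the order is such a v, and thus |S| ≤ 3D + 7.
--
-- Call a vertex big if more than D/2 of its in-neighbours are in S; there are at
-- most 12 of these. Let T be S without the big vertices and their out-neighbours.
-- Arcs and paths from a member of T with two big out-neighbours end outside T.
-- Hence, if some member of T does not have two big out-neighbours, the first one
-- is reached by nothing in T, shares out-neighbours with at most D + D/2 members,
-- and |T| ≤ 5/2 D + 7. Otherwise nothing in T reaches T, and T is the edge set of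
-- a multigraph of maximum degree at most D in which every edge is disjoint from
-- at most D + 7 others. Such a multigraph has at most 5/2 (D + 7) edges: this is
-- read off the star of a vertex of least positive degree.

open import Defs
open import Data.Bool.Base using (true; false; if_then_else_)
open import Data.Fin.Base using (Fin; zero; suc)
open import Data.Fin.Properties using (_≟_; any?)
open import Data.Fin.Subset using (Subset; _-_; ∣_∣; ⊤) renaming (_∈_ to _∈ₛ_)
open import Data.Fin.Subset.Properties
  using (nonempty?; x∈p∧x≢y⇒x∈p-y; x∈p⇒∣p-x∣<∣p∣; ∈⊤) renaming (_∈?_ to _∈ₛ?_)
import Data.Integer.Base as ℤ
import Data.Integer.Properties as ℤ
open import Data.List.Base using (List; []; _∷_; length; map; allFin)
open import Data.List.Extrema.Nat using (xs≤max)
import Data.List.Membership.DecPropositional as DecMembership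
open import Data.List.Membership.Propositional using (_∈_)
open import Data.List.Membership.Propositional.Properties using (∈-map⁺; ∈-allFin)
import Data.List.Relation.Unary.All as All
open import Data.List.Relation.Unary.All.Properties using (all-filter) renaming (map⁺ to All-map⁺)
open import Data.List.Relation.Unary.Any using (here; there)
open import Data.Nat.Base as ℕ using (ℕ; NonZero; zero; suc; _+_; _*_; _≤_; _<_; _∸_; z≤n; s≤s)
open import Data.Nat.Induction using (<-wellFounded)
open import Data.Nat.Properties hiding (_≟_)
open import Data.Nat.Tactic.RingSolver using (solve-∀)
open import Data.Product.Base using (∃; _×_; _,_; proj₁; proj₂)
open import Data.Rational.Base as ℚ using (_/_)
import Data.Rational.Properties as ℚ
import Data.Rational.Unnormalised.Base as ℚᵘ
import Data.Rational.Unnormalised.Properties as ℚᵘ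
open import Data.Sum.Base using (_⊎_; inj₁; inj₂; [_,_]′)
open import Data.Vec.Base using ([]; _∷_; tabulate)
open import Function.Base using (_∘_; id)
open import Induction.WellFounded using (Acc; acc)
open import Level using (0ℓ)
open import Relation.Binary.Definitions using () renaming (Decidable to Decidable₂)
open import Relation.Binary.PropositionalEquality
open import Relation.Nullary.Decidable
  using (Dec; does; yes; no; _×-dec_; _⊎-dec_; ¬?; toSum; decidable-stable)
open import Relation.Nullary.Negation using (¬_; contradiction)
open import Relation.Unary using (Pred; Decidable)
open import Algebra.Properties.Semiring.Sum +-*-semiring
  using (sum; ∑-comm; ∑-distrib-+; *-distribˡ-sum; *-distribʳ-sum; sum-replicate-zero)
open import Data.List.Extrema ≤-totalOrder using (argmax-all)

-- Arithmetic of the least star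

-- Refutes a sum of inequalities whose left side exceeds its right side by an identity that
-- `solve-∀` proves.
excess : ∀ {x y} z → x ≤ y → ¬ x ≡ 1 + (y + z)
excess {y = y} z x≤y refl = <-irrefl refl (≤-trans (s≤s (m≤m+n y z)) x≤y)

-- The case `m ≤ 1 + l` of the star inequality, with `m + j = 1 + l` and `t = l - 1`. There `d` has
-- coefficient `j` on the left, so `low` bounds it from below; once `large` has removed `N`, the
-- rest contradicts `2m + 4j ≤ 5t`, which is `10 ≤ 3m + j`.
manyNonNeighbours : ∀ {d N Q} m j t → m + j ≡ 2 + t → 10 ≤ 3 * m + j →
  5 * Q < 2 * N → N < d + 2 * Q →
  ¬ (m + j) * d + m * N ≤ m * d + m * Q + 2 * N
manyNonNeighbours {d} {N} {Q} m j t m+j≡2+t 10≤ large low star =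
  <⇒≱ bounded withoutN
  where
  open ≤-Reasoning

  withoutN : 2 * j + t * (1 + 5 * Q) ≤ (2 * m + 4 * j) * Q
  withoutN = +-cancelˡ-≤ (2 * ((m + j) * d) + 2 * ((m + j) * N)) _ _ (begin
    2 * ((m + j) * d) + 2 * ((m + j) * N) + (2 * j + t * (1 + 5 * Q))
      ≡⟨ eq₁ m j d N t (t * (1 + 5 * Q)) ⟩
    2 * ((m + j) * d + m * N) + 2 * j * (1 + N) + t * (1 + 5 * Q)
      ≤⟨ +-mono-≤ (+-mono-≤ (*-monoʳ-≤ 2 star) (*-monoʳ-≤ (2 * j) low)) (*-monoʳ-≤ t large) ⟩
    2 * (m * d + m * Q + 2 * N) + 2 * j * (d + 2 * Q) + t * (2 * N)
      ≡⟨ eq₂ m j d N Q t ⟩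
    2 * ((m + j) * d) + 2 * ((2 + t) * N) + (2 * m + 4 * j) * Q
      ≡⟨ cong (λ x → 2 * ((m + j) * d) + 2 * (x * N) + (2 * m + 4 * j) * Q) m+j≡2+t ⟨
    2 * ((m + j) * d) + 2 * ((m + j) * N) + (2 * m + 4 * j) * Q ∎)
    where
    eq₁ : ∀ m j d N t x → 2 * ((m + j) * d) + 2 * ((m + j) * N) + (2 * j + x) ≡
      2 * ((m + j) * d + m * N) + 2 * j * (1 + N) + x
    eq₁ = solve-∀
    eq₂ : ∀ m j d N Q t →
      2 * (m * d + m * Q + 2 * N) + 2 * j * (d + 2 * Q) + t * (2 * N) ≡
      2 * ((m + j) * d) + 2 * ((2 + t) * N) + (2 * m + 4 * j) * Q
    eq₂ = solve-∀

  2m+4j≤5t : 2 * m + 4 * j ≤ 5 * t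
  2m+4j≤5t = +-cancelˡ-≤ 10 _ _ (begin
    10 + (2 * m + 4 * j)        ≤⟨ +-monoˡ-≤ (2 * m + 4 * j) 10≤ ⟩
    3 * m + j + (2 * m + 4 * j) ≡⟨ eq₁ m j ⟩
    5 * (m + j)                 ≡⟨ cong (5 *_) m+j≡2+t ⟩
    5 * (2 + t)                 ≡⟨ *-distribˡ-+ 5 2 t ⟩
    10 + 5 * t                  ∎)
    where
    eq₁ : ∀ m j → 3 * m + j + (2 * m + 4 * j) ≡ 5 * (m + j)
    eq₁ = solve-∀

  bounded : (2 * m + 4 * j) * Q < 2 * j + t * (1 + 5 * Q)
  bounded = begin-strict
    (2 * m + 4 * j) * Q       ≤⟨ *-monoˡ-≤ Q 2m+4j≤5t ⟩
    5 * t * Q                 <⟨ m<n+m (5 * t * Q) 0<2j+t ⟩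
    2 * j + t + 5 * t * Q     ≡⟨ eq j t Q ⟩
    2 * j + t * (1 + 5 * Q)   ∎
    where
    eq : ∀ j t Q → 2 * j + t + 5 * t * Q ≡ 2 * j + t * (1 + 5 * Q)
    eq = solve-∀
    0<2j+t : 0 < 2 * j + t
    0<2j+t = ≰⇒> λ z → <⇒≱ {9} 10≤ (begin
      3 * m + j                 ≤⟨ m≤m+n _ (2 * j) ⟩
      3 * m + j + 2 * j         ≡⟨ eq₁ m j ⟩
      3 * (m + j)               ≡⟨ cong (3 *_) m+j≡2+t ⟩
      3 * (2 + t)               ≤⟨ *-monoʳ-≤ 3 (+-monoʳ-≤ 2 (≤-trans (m≤n+m t (2 * j)) z)) ⟩
      6                         ≤⟨ m≤m+n 6 3 ⟩
      9                         ∎)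
      where
      eq₁ : ∀ m j → 3 * m + j + 2 * j ≡ 3 * (m + j)
      eq₁ = solve-∀

-- The case `1 + l ≤ m`. Now `d` has coefficient `j` on the right, so an upper bound on it is
-- wanted: the least degree is at most the average, `k * d ≤ 2 * N` for `k = m + l`.
manyNeighbours : ∀ {d N Q} j m l → m ≡ 1 + l + j → 5 * Q < 2 * N → 6 ≤ m + l → 0 < l →
  (m + l) * d ≤ 2 * N →
  ¬ (1 + l) * d + m * N ≤ m * d + m * Q + 2 * N
manyNeighbours {d} {N} {Q} j m l m≡ large k≥6 0<l min star = final (m≤n⇒m<n∨m≡n k≥6)
  where
  k P W : ℕ
  k = m + l
  P = k * m
  W = k + j

  cancelled : m * N ≤ m * Q + 2 * N + j * d
  cancelled = +-cancelˡ-≤ (m * d) _ _ (≤-trans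
    (≤-trans (≤-reflexive lhs) (+-monoˡ-≤ (j * d) star)) (≤-reflexive (rhs (m * d) (m * Q) N (j * d))))
    where
    lhs : m * d + m * N ≡ (1 + l) * d + m * N + j * d
    lhs = trans (cong (λ x → x * d + m * N) m≡) (eq d (m * N) l j)
      where
      eq : ∀ d x l j → (1 + l + j) * d + x ≡ (1 + l) * d + x + j * d
      eq = solve-∀
    rhs : ∀ x y N z → x + y + 2 * N + z ≡ x + (y + 2 * N + z)
    rhs = solve-∀

  scaled : P * N ≤ P * Q + 2 * (W * N)
  scaled = begin
    P * N                                   ≡⟨ *-assoc k m N ⟩
    k * (m * N)                             ≤⟨ *-monoʳ-≤ k cancelled ⟩
    k * (m * Q + 2 * N + j * d)             ≡⟨ eq₁ k m Q N j d ⟩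
    P * Q + 2 * (k * N) + j * (k * d)       ≤⟨ +-monoʳ-≤ (P * Q + 2 * (k * N)) (*-monoʳ-≤ j min) ⟩
    P * Q + 2 * (k * N) + j * (2 * N)       ≡⟨ eq₂ P Q N k j ⟩
    P * Q + 2 * (W * N)                     ∎
    where
    open ≤-Reasoning
    eq₁ : ∀ k m Q N j d →
      k * (m * Q + 2 * N + j * d) ≡ k * m * Q + 2 * (k * N) + j * (k * d)
    eq₁ = solve-∀
    eq₂ : ∀ P Q N k j →
      P * Q + 2 * (k * N) + j * (2 * N) ≡ P * Q + 2 * ((k + j) * N)
    eq₂ = solve-∀

  -- Since `W = 2m - 1` and not `2m`, a term `10 * N` is left over. It decides the case `k = 6`,
  -- where the left side otherwise falls short by up to `2 * m * N` and `l ≥ 1` forces `m ≤ 5`.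
  withoutQ : m * (3 * (k * N) + k) + 10 * N ≤ m * (20 * N)
  withoutQ = +-cancelˡ-≤ (2 * (P * N) + 5 * (P * Q)) _ _ (begin
    2 * (P * N) + 5 * (P * Q) + (m * (3 * (k * N) + k) + 10 * N)
      ≡⟨ eq₁ k m N Q ⟩
    5 * (P * N) + P * (1 + 5 * Q) + 10 * N
      ≤⟨ +-monoˡ-≤ (10 * N) (+-mono-≤ (*-monoʳ-≤ 5 scaled) (*-monoʳ-≤ P large)) ⟩
    5 * (P * Q + 2 * (W * N)) + P * (2 * N) + 10 * N
      ≡⟨ eq₂ P Q N W ⟩
    2 * (P * N) + 5 * (P * Q) + 10 * ((1 + W) * N)
      ≡⟨ cong (λ x → 2 * (P * N) + 5 * (P * Q) + 10 * (x * N)) 1+W≡2m ⟩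
    2 * (P * N) + 5 * (P * Q) + 10 * (2 * m * N)
      ≡⟨ eq₃ P Q N m ⟩
    2 * (P * N) + 5 * (P * Q) + m * (20 * N) ∎)
    where
    open ≤-Reasoning
    eq₁ : ∀ k m N Q →
      2 * (k * m * N) + 5 * (k * m * Q) + (m * (3 * (k * N) + k) + 10 * N) ≡
      5 * (k * m * N) + k * m * (1 + 5 * Q) + 10 * N
    eq₁ = solve-∀
    eq₂ : ∀ P Q N W →
      5 * (P * Q + 2 * (W * N)) + P * (2 * N) + 10 * N ≡
      2 * (P * N) + 5 * (P * Q) + 10 * ((1 + W) * N)
    eq₂ = solve-∀
    eq₃ : ∀ P Q N m → 2 * (P * N) + 5 * (P * Q) + 10 * (2 * m * N) ≡
      2 * (P * N) + 5 * (P * Q) + m * (20 * N)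
    eq₃ = solve-∀
    1+W≡2m : 1 + W ≡ 2 * m
    1+W≡2m = trans (eq m l j) (trans (cong (m +_) (sym m≡)) (cong (m +_) (sym (+-identityʳ m))))
      where
      eq : ∀ m l j → 1 + (m + l + j) ≡ m + (1 + l + j)
      eq = solve-∀

  0<m : 0 < m
  0<m = subst (0 <_) (sym m≡) (s≤s z≤n)

  final : ¬ (6 < k ⊎ 6 ≡ k)
  final (inj₁ 7≤k) = <⇒≱ (begin-strict
    m * (20 * N)                     ≤⟨ *-monoʳ-≤ m (*-monoˡ-≤ N {20} {21} (n≤1+n 20)) ⟩
    m * (21 * N)                     ≡⟨ cong (m *_) (*-assoc 3 7 N) ⟩
    m * (3 * (7 * N))                ≤⟨ *-monoʳ-≤ m (*-monoʳ-≤ 3 (*-monoˡ-≤ N 7≤k)) ⟩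
    m * (3 * (k * N))                ≡⟨ +-identityʳ _ ⟨
    m * (3 * (k * N)) + 0            <⟨ +-monoʳ-< (m * (3 * (k * N))) (*-mono-≤ 0<m (≤-trans (s≤s z≤n) k≥6)) ⟩
    m * (3 * (k * N)) + m * k        ≡⟨ *-distribˡ-+ m (3 * (k * N)) k ⟨
    m * (3 * (k * N) + k)            ≤⟨ m≤m+n _ (10 * N) ⟩
    m * (3 * (k * N) + k) + 10 * N   ∎) withoutQ
    where open ≤-Reasoning
  final (inj₂ 6≡k) = <⇒≱ (begin-strict
    m * (20 * N)                         ≡⟨ eq₁ m N ⟩
    m * (18 * N) + 2 * (m * N)           <⟨ +-monoʳ-< (m * (18 * N)) (m<n+m (2 * (m * N)) {m * 6} (*-mono-≤ 0<m (s≤s {n = 5} z≤n))) ⟩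
    m * (18 * N) + (m * 6 + 2 * (m * N)) ≤⟨ +-monoʳ-≤ (m * (18 * N)) (+-monoʳ-≤ (m * 6) (*-monoʳ-≤ 2 (*-monoˡ-≤ N m≤5))) ⟩
    m * (18 * N) + (m * 6 + 2 * (5 * N)) ≡⟨ eq₂ m N ⟩
    m * (3 * (6 * N) + 6) + 10 * N       ≡⟨ cong (λ x → m * (3 * (x * N) + x) + 10 * N) 6≡k ⟩
    m * (3 * (k * N) + k) + 10 * N       ∎) withoutQ
    where
    open ≤-Reasoning
    m≤5 : m ≤ 5
    m≤5 = +-cancelʳ-≤ 1 m 5 (≤-trans (+-monoʳ-≤ m 0<l) (≤-reflexive (sym 6≡k)))
    eq₁ : ∀ m N → m * (20 * N) ≡ m * (18 * N) + 2 * (m * N)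
    eq₁ = solve-∀
    eq₂ : ∀ m N → m * (18 * N) + (m * 6 + 2 * (5 * N)) ≡ m * (3 * (6 * N) + 6) + 10 * N
    eq₂ = solve-∀

-- In a multigraph with N edges, u is a vertex of least positive degree d, with m
-- neighbours, and l counts the other vertices of positive degree, u included.
-- For a neighbour w, the fifth hypothesis uses d(u) + d(w) - μ(u,w) ≥ N - Q,
-- which holds as an edge uw is disjoint from at most Q edges; for the others it
-- uses d(w) ≥ d(u).
¬5Q<2N : ∀ {d N Q} m l → 0 < d → d ≤ Q → N < d + 2 * Q → 0 < l →
  (1 + l) * d + m * N ≤ m * d + m * Q + 2 * N →
  (m + l) * d ≤ 2 * N → 2 * N ≤ (m + l) * Q →
  d + m * N ≤ m * d + 2 * (m * Q) → ¬ 5 * Q < 2 * N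
¬5Q<2N {d} {N} {Q} m (suc l) 0<d d≤Q low _ star min sum few large =
  byCases (≤-total m (2 + l))
  where
  -- For `m = 0`, `few` gives `d ≤ 0`; for `m = 1` it gives `N ≤ 2Q`; for `m = 2` it gives
  -- `2N ≤ d + 4Q ≤ 5Q`.
  m≥3 : 3 ≤ m
  m≥3 = ≰⇒> (atMost2 m few)
    where
    atMost2 : ∀ m → d + m * N ≤ m * d + 2 * (m * Q) → ¬ m ≤ 2
    atMost2 0 few _ = <⇒≱ 0<d (m+n≤o⇒m≤o _ few)
    atMost2 1 few _ = excess Q (+-mono-≤ large (*-monoʳ-≤ 2 few)) (eq d N Q)
      where
      eq : ∀ d N Q → (1 + 5 * Q) + 2 * (d + 1 * N) ≡
        1 + (2 * N + 2 * (1 * d + 2 * (1 * Q)) + Q)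
      eq = solve-∀
    atMost2 2 few _ = excess 0 (+-mono-≤ large (+-mono-≤ few d≤Q)) (eq d N Q)
      where
      eq : ∀ d N Q → (1 + 5 * Q) + ((d + 2 * N) + d) ≡
        1 + (2 * N + (2 * d + 2 * (2 * Q) + Q) + 0)
      eq = solve-∀
    atMost2 (suc (suc (suc _))) _ (s≤s (s≤s ()))

  k≥6 : 6 ≤ m + suc l
  k≥6 = ≰⇒> λ k≤5 → <⇒≱ large (≤-trans sum (*-monoˡ-≤ Q k≤5))

  -- The coefficient of `d` in `star` is `2 + l - m`, as `l` is here one less than in the statement.
  -- Its sign decides between a lower and an upper bound on `d`.
  byCases : ¬ (m ≤ 2 + l ⊎ 2 + l ≤ m)
  byCases (inj₁ m≤l) = manyNonNeighbours {d} {N} {Q} m j l split 10≤ large low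
    (subst (λ x → x * d + m * N ≤ m * d + m * Q + 2 * N) (sym split) star)
    where
    j : ℕ
    j = 2 + l ∸ m
    split : m + j ≡ 2 + l
    split = m+[n∸m]≡n m≤l
    10≤ : 10 ≤ 3 * m + j
    10≤ = begin
      3 + (6 + 1)         ≤⟨ +-mono-≤ m≥3 (+-monoˡ-≤ 1 k≥6) ⟩
      m + (m + suc l + 1) ≡⟨ cong (m +_) (trans (+-assoc m (suc l) 1) (cong (m +_) (trans (+-comm (suc l) 1) (sym split)))) ⟩
      m + (m + (m + j))   ≡⟨ eq m j ⟩
      3 * m + j           ∎
      where
      open ≤-Reasoning
      eq : ∀ m j → m + (m + (m + j)) ≡ 3 * m + j
      eq = solve-∀
  byCases (inj₂ l<m) = manyNeighbours {d} {N} {Q} (m ∸ (2 + l)) m (suc l)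
    (sym (m+[n∸m]≡n l<m)) large k≥6 (s≤s z≤n) min star

-- Counting

module _ {n : ℕ} where
  open DecMembership (_≟_ {n}) public using (_∈?_)

sum-mono : ∀ {n} {f g : Fin n → ℕ} → (∀ i → f i ≤ g i) → sum f ≤ sum g
sum-mono {zero}  f≤g = z≤n
sum-mono {suc n} f≤g = +-mono-≤ (f≤g zero) (sum-mono (f≤g ∘ suc))

term≤sum : ∀ {n} (f : Fin n → ℕ) i → f i ≤ sum f
term≤sum f zero    = m≤m+n _ _
term≤sum f (suc i) = ≤-trans (term≤sum (f ∘ suc) i) (m≤n+m _ _)

0<sum⇒∃ : ∀ {n} (f : Fin n → ℕ) → 0 < sum f → ∃ λ i → 0 < f i
0<sum⇒∃ {suc n} f 0<Σ with f zero in f₀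
... | suc _ = zero , subst (0 <_) (sym f₀) (s≤s z≤n)
... | zero  = let i , 0<fi = 0<sum⇒∃ (f ∘ suc) 0<Σ in suc i , 0<fi

⟦_⟧ : {A : Set} → Dec A → ℕ
⟦ a ⟧ = if does a then 1 else 0

module _ {A : Set} where

  ⟦⟧≤ : ∀ {x} (a : Dec A) → (A → 1 ≤ x) → ⟦ a ⟧ ≤ x
  ⟦⟧≤ (yes a) bound = bound a
  ⟦⟧≤ (no _)  _     = z≤n

  1≤⟦⟧ : (a : Dec A) → A → 1 ≤ ⟦ a ⟧
  1≤⟦⟧ (yes _) _ = ≤-refl
  1≤⟦⟧ (no ¬a) a = contradiction a ¬a

module _ {n : ℕ} where

  -- Cardinality as a sum of indicators, so that double counting is the exchange of two finite sums.
  # : {P : Pred (Fin n) 0ℓ} → Decidable P → ℕ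
  # P? = sum λ i → ⟦ P? i ⟧

  module _ {P Q : Pred (Fin n) 0ℓ} (P? : Decidable P) (Q? : Decidable Q) where

    #-mono : (∀ {i} → P i → Q i) → # P? ≤ # Q?
    #-mono P⊆Q = sum-mono λ i → ⟦⟧≤ (P? i) (1≤⟦⟧ (Q? i) ∘ P⊆Q)

    module _ {R : Pred (Fin n) 0ℓ} (R? : Decidable R) where

      #-∪ : (∀ {i} → P i → Q i ⊎ R i) → # P? ≤ # Q? + # R?
      #-∪ P⊆Q∪R = ≤-trans
        (sum-mono λ i → ⟦⟧≤ (P? i) λ Pi →
          [ (λ Qi → ≤-trans (1≤⟦⟧ (Q? i) Qi) (m≤m+n _ _))
          , (λ Ri → ≤-trans (1≤⟦⟧ (R? i) Ri) (m≤n+m _ _)) ]′ (P⊆Q∪R Pi))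
        (≤-reflexive (∑-distrib-+ (λ i → ⟦ Q? i ⟧) (λ i → ⟦ R? i ⟧)))

      #-disjoint : (∀ {i} → P i → R i) → (∀ {i} → Q i → R i) →
        (∀ {i} → P i → ¬ Q i) → # P? + # Q? ≤ # R?
      #-disjoint P⊆R Q⊆R P∩Q = ≤-trans
        (≤-reflexive (sym (∑-distrib-+ (λ i → ⟦ P? i ⟧) (λ i → ⟦ Q? i ⟧))))
        (sum-mono pointwise)
        where
        pointwise : ∀ i → ⟦ P? i ⟧ + ⟦ Q? i ⟧ ≤ ⟦ R? i ⟧
        pointwise i with P? i | Q? i
        ... | yes p | yes q = contradiction q (P∩Q p)
        ... | yes p | no _  = 1≤⟦⟧ (R? i) (P⊆R p)
        ... | no _  | yes q = 1≤⟦⟧ (R? i) (Q⊆R q)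
        ... | no _  | no _  = z≤n

  #-exchange : {P Q R S : Pred (Fin n) 0ℓ}
    (P? : Decidable P) (Q? : Decidable Q) (R? : Decidable R) (S? : Decidable S) →
    (∀ {i} → P i → R i ⊎ S i) → (∀ {i} → Q i → R i × S i) →
    # P? + # Q? ≤ # R? + # S?
  #-exchange P? Q? R? S? P⊆R∪S Q⊆R∩S = begin
    # P? + # Q?                        ≡⟨ ∑-distrib-+ (λ i → ⟦ P? i ⟧) (λ i → ⟦ Q? i ⟧) ⟨
    sum (λ i → ⟦ P? i ⟧ + ⟦ Q? i ⟧)    ≤⟨ sum-mono pointwise ⟩
    sum (λ i → ⟦ R? i ⟧ + ⟦ S? i ⟧)    ≡⟨ ∑-distrib-+ (λ i → ⟦ R? i ⟧) (λ i → ⟦ S? i ⟧) ⟩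
    # R? + # S? ∎
    where
    open ≤-Reasoning
    pointwise : ∀ i → ⟦ P? i ⟧ + ⟦ Q? i ⟧ ≤ ⟦ R? i ⟧ + ⟦ S? i ⟧
    pointwise i with P? i | Q? i
    ... | p | yes q = let r , s = Q⊆R∩S q in ≤-trans
      (+-monoˡ-≤ 1 (⟦⟧≤ p λ _ → 1≤⟦⟧ (R? i) r)) (+-monoʳ-≤ ⟦ R? i ⟧ (1≤⟦⟧ (S? i) s))
    ... | p | no _  = ≤-trans (≤-reflexive (+-identityʳ _)) (⟦⟧≤ p λ Pi →
      [ (λ r → ≤-trans (1≤⟦⟧ (R? i) r) (m≤m+n _ _))
      , (λ s → ≤-trans (1≤⟦⟧ (S? i) s) (m≤n+m _ _)) ]′ (P⊆R∪S Pi))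

  module _ {P : Pred (Fin n) 0ℓ} (P? : Decidable P) where

    #-∅ : (∀ i → ¬ P i) → # P? ≤ 0
    #-∅ ¬P = ≤-trans (sum-mono λ i → ⟦⟧≤ (P? i) λ Pi → contradiction Pi (¬P i))
                     (≤-reflexive (sum-replicate-zero n))

    0<# : ∀ {i} → P i → 0 < # P?
    0<# {i} Pi = ≤-trans (1≤⟦⟧ (P? i) Pi) (term≤sum (λ i → ⟦ P? i ⟧) i)

    0<#⇒∃ : 0 < # P? → ∃ P
    0<#⇒∃ 0<# with any? P?
    ... | yes ∃P = ∃P
    ... | no ¬∃P = contradiction (#-∅ λ i Pi → ¬∃P (i , Pi)) (<⇒≱ 0<#)

#-≡ : ∀ {n} (a : Fin n) → # (_≟ a) ≡ 1
#-≡ {suc n} zero    = cong suc (sum-replicate-zero n)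
#-≡ {suc n} (suc a) = #-≡ a

#-∈ : ∀ {n} (xs : List (Fin n)) → # (_∈? xs) ≤ length xs
#-∈ {n} []   = #-∅ {n} (_∈? []) λ _ ()
#-∈ (x ∷ xs) = ≤-trans
  (#-∪ (_∈? (x ∷ xs)) (_≟ x) (_∈? xs)
    λ { (here eq) → inj₁ eq ; (there i∈xs) → inj₂ i∈xs })
  (+-mono-≤ (≤-reflexive (#-≡ x)) (#-∈ xs))

#-⋃ : ∀ {m n k} {Q : Pred (Fin m) 0ℓ} (Q? : Decidable Q) (xs : Fin m → List (Fin n)) →
  (∀ i → length (xs i) ≤ k) →
  # (λ u → any? λ i → Q? i ×-dec (u ∈? xs i)) ≤ # Q? * k
#-⋃ {k = k} Q? xs short = begin
  # (λ u → any? λ i → Q? i ×-dec (u ∈? xs i))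
    ≤⟨ sum-mono (λ u → ⟦⟧≤ (any? λ i → Q? i ×-dec (u ∈? xs i)) λ (i , Qi , u∈) →
         ≤-trans (*-mono-≤ (1≤⟦⟧ (Q? i) Qi) (1≤⟦⟧ (u ∈? xs i) u∈))
                 (term≤sum (λ i → ⟦ Q? i ⟧ * ⟦ u ∈? xs i ⟧) i)) ⟩
  sum (λ u → sum λ i → ⟦ Q? i ⟧ * ⟦ u ∈? xs i ⟧)
    ≡⟨ ∑-comm (λ u i → ⟦ Q? i ⟧ * ⟦ u ∈? xs i ⟧) ⟩
  sum (λ i → sum λ u → ⟦ Q? i ⟧ * ⟦ u ∈? xs i ⟧)
    ≤⟨ sum-mono (λ i → ≤-trans
         (≤-reflexive (sym (*-distribˡ-sum ⟦ Q? i ⟧ (λ u → ⟦ u ∈? xs i ⟧))))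
         (*-monoʳ-≤ ⟦ Q? i ⟧ (≤-trans (#-∈ (xs i)) (short i)))) ⟩
  sum (λ i → ⟦ Q? i ⟧ * k)
    ≡⟨ *-distribʳ-sum k (λ i → ⟦ Q? i ⟧) ⟨
  # Q? * k ∎
  where open ≤-Reasoning

-- A further element besides two distinct ones would make the count at least 3. `p` and `q` may
-- coincide, and `v` is the default for an empty `P`.
#≤2⇒⊆pair : ∀ {n} {P : Pred (Fin n) 0ℓ} (P? : Decidable P) (v : Fin n) → # P? ≤ 2 →
  ∃ λ p → ∃ λ q → ∀ {w} → P w → w ≡ p ⊎ w ≡ q
#≤2⇒⊆pair P? v #≤2 with any? P?
... | no ¬∃ = v , v , λ Pw → contradiction (_ , Pw) ¬∃
... | yes (p , Pp) with any? (λ w → P? w ×-dec ¬? (w ≟ p))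
...   | no ¬∃ = p , p , λ {w} Pw → [ inj₁ , (λ w≢p → contradiction (w , Pw , w≢p) ¬∃) ]′ (toSum (w ≟ p))
...   | yes (q , Pq , q≢p) = p , q , λ {w} Pw → cover Pw (w ≟ p) (w ≟ q)
  where
  cover : ∀ {w} → _ → Dec (w ≡ p) → Dec (w ≡ q) → w ≡ p ⊎ w ≡ q
  cover _ (yes w≡p) _ = inj₁ w≡p
  cover _ (no _) (yes w≡q) = inj₂ w≡q
  cover {w} Pw (no w≢p) (no w≢q) = contradiction #≤2 (<⇒≱ (begin
    3                                 ≡⟨ cong₂ _+_ (#-≡ w) (cong₂ _+_ (#-≡ q) (#-≡ p)) ⟨
    # (_≟ w) + (# (_≟ q) + # (_≟ p))  ≤⟨ +-monoʳ-≤ (# (_≟ w)) (#-disjoint (_≟ q) (_≟ p) qp? inj₁ inj₂ λ { refl → q≢p }) ⟩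
    # (_≟ w) + # qp?                  ≤⟨ #-disjoint (_≟ w) qp? P? (λ { refl → Pw }) (λ { (inj₁ refl) → Pq ; (inj₂ refl) → Pp })
                                           (λ { refl → [ w≢q , w≢p ]′ }) ⟩
    # P? ∎))
    where
    open ≤-Reasoning
    qp? : Decidable (λ x → x ≡ q ⊎ x ≡ p)
    qp? x = (x ≟ q) ⊎-dec (x ≟ p)

minimiser : ∀ {n} {P : Pred (Fin n) 0ℓ} (P? : Decidable P) (f : Fin n → ℕ) → ∃ P →
  ∃ λ i → P i × ∀ {j} → P j → f i ≤ f j
minimiser {P = P} P? f (i , Pi) = descend i Pi (<-wellFounded (f i))
  where
  descend : ∀ i → P i → Acc _<_ (f i) → ∃ λ i → P i × ∀ {j} → P j → f i ≤ f j
  descend i Pi (acc below) with any? (λ j → P? j ×-dec (f j <? f i))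
  ... | yes (j , Pj , fj<fi) = descend j Pj (below fj<fi)
  ... | no ¬∃ = i , Pi , λ Pj → ≮⇒≥ λ fj<fi → ¬∃ (_ , Pj , fj<fi)

-- Degeneracy and orientations

∣tabulate∣ : ∀ {n} {P : Pred (Fin n) 0ℓ} (P? : Decidable P) →
  ∣ tabulate (λ i → does (P? i)) ∣ ≡ # P?
∣tabulate∣ {zero}  P? = refl
∣tabulate∣ {suc n} P? with P? zero
... | yes _ = cong suc (∣tabulate∣ (P? ∘ suc))
... | no _  = ∣tabulate∣ (P? ∘ suc)

∣S∣≡# : ∀ {n} (S : Subset n) → ∣ S ∣ ≡ # (_∈ₛ? S)
∣S∣≡# []          = refl
∣S∣≡# (true ∷ S)  = cong suc (∣S∣≡# S)
∣S∣≡# (false ∷ S) = ∣S∣≡# S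

module _ {n} (G : Graph n) where

  Oriented : (rank : Fin n → ℕ) (p q : Fin n → Fin n) → Fin n → Fin n → Set
  Oriented rank p q u w = rank u < rank w × (w ≡ p u ⊎ w ≡ q u)

  -- p u and q u only cover the out-neighbours of u: they may coincide and need
  -- not be adjacent to u.
  record Orientation (V : Subset n) : Set where
    field
      rank   : Fin n → ℕ
      p q    : Fin n → Fin n
      orient : ∀ {u w} → u ∈ₛ V → w ∈ₛ V → Adj G u w →
               Oriented rank p q u w ⊎ Oriented rank p q w u

  induced : Subset n → Subgraph G
  induced V .vertices = V
  induced V .edges .Adj u v = Adj G u v × u ∈ₛ V × v ∈ₛ V
  induced V .edges .adj? u v = adj? G u v ×-dec ((u ∈ₛ? V) ×-dec (v ∈ₛ? V))
  induced V .edges .adj-sym (a , u∈V , v∈V) = adj-sym G a , v∈V , u∈V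
  induced V .edges .adj-irrefl eq (a , _) = adj-irrefl G eq a
  induced V .edges⊆ = proj₁
  induced V .ends = proj₂

  -- Induction on the size of `V`. A vertex `v` of degree at most 2 in the induced subgraph is put
  -- first: it gets rank 0, the ranks found for `V - v` are shifted by one, and all edges at `v`
  -- become arcs leaving it.
  orientation : Degenerate 2 G → ∀ V → Acc _<_ ∣ V ∣ → Orientation V
  orientation degenerate V (acc smaller) with nonempty? V
  ... | no empty = record
    { rank = λ _ → 0 ; p = id ; q = id ; orient = λ u∈V → contradiction (_ , u∈V) empty }
  ... | yes nonempty = record
    { rank = λ w → extend 0 (suc (rank w)) (w ≟ v)
    ; p = λ w → extend a (p w) (w ≟ v) ; q = λ w → extend b (q w) (w ≟ v)
    ; orient = λ {u} {w} → extended (u ≟ v) (w ≟ v) }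
    where
    v = proj₁ (degenerate (induced V) nonempty)
    v∈V = proj₁ (proj₂ (degenerate (induced V) nonempty))
    later = #≤2⇒⊆pair (adj? (edges (induced V)) v) v
      (subst (_≤ 2) (∣tabulate∣ (adj? (edges (induced V)) v))
        (proj₂ (proj₂ (degenerate (induced V) nonempty))))
    a = proj₁ later
    b = proj₁ (proj₂ later)
    open Orientation (orientation degenerate (V - v) (smaller (x∈p⇒∣p-x∣<∣p∣ v∈V)))

    extend : ∀ {A : Set} {w} → A → A → Dec (w ≡ v) → A
    extend x y (yes _) = x
    extend x y (no _)  = y

    -- The two decisions are arguments, so that matching on them evaluates the new `rank`, `p` and
    -- `q` together.
    extended : ∀ {u w} (u≟v : Dec (u ≡ v)) (w≟v : Dec (w ≡ v)) →
      u ∈ₛ V → w ∈ₛ V → Adj G u w →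
      (extend 0 (suc (rank u)) u≟v < extend 0 (suc (rank w)) w≟v ×
        (w ≡ extend a (p u) u≟v ⊎ w ≡ extend b (q u) u≟v)) ⊎
      (extend 0 (suc (rank w)) w≟v < extend 0 (suc (rank u)) u≟v ×
        (u ≡ extend a (p w) w≟v ⊎ u ≡ extend b (q w) w≟v))
    extended (yes refl) (yes refl) _ _ uw = contradiction uw (adj-irrefl G refl)
    extended (yes refl) (no _) u∈V w∈V uw =
      inj₁ (s≤s z≤n , proj₂ (proj₂ later) (uw , u∈V , w∈V))
    extended (no _) (yes refl) u∈V w∈V uw =
      inj₂ (s≤s z≤n , proj₂ (proj₂ later) (adj-sym G uw , w∈V , u∈V))
    extended (no u≢v) (no w≢v) u∈V w∈V uw
      with orient (x∈p∧x≢y⇒x∈p-y u∈V u≢v) (x∈p∧x≢y⇒x∈p-y w∈V w≢v) uw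
    ... | inj₁ (u<w , out) = inj₁ (s≤s u<w , out)
    ... | inj₂ (w<u , out) = inj₂ (s≤s w<u , out)

-- Arcs, shared out-neighbours and sources

module Arcs {n} (G : Graph n) (orientation : Orientation G ⊤) where
  open Orientation orientation

  infix 4 _⇒_ _⇒?_

  _⇒_ : Fin n → Fin n → Set
  u ⇒ w = Adj G u w × rank u < rank w

  _⇒?_ : Decidable₂ _⇒_
  u ⇒? w = adj? G u w ×-dec (rank u <? rank w)

  out : ∀ {u w} → u ⇒ w → w ≡ p u ⊎ w ≡ q u
  out (uw , u<w) with orient ∈⊤ ∈⊤ uw
  ... | inj₁ (_ , w∈) = w∈
  ... | inj₂ (w<u , _) = contradiction u<w (<-asym w<u)

  direct : ∀ {u w} → Adj G u w → u ⇒ w ⊎ w ⇒ u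
  direct uw with orient ∈⊤ ∈⊤ uw
  ... | inj₁ (u<w , _) = inj₁ (uw , u<w)
  ... | inj₂ (w<u , _) = inj₂ (adj-sym G uw , w<u)

  ShareOut : Fin n → Fin n → Set
  ShareOut e u = ∃ λ h → e ⇒ h × u ⇒ h

  shareOut? : Decidable₂ ShareOut
  shareOut? e u = any? λ h → (e ⇒? h) ×-dec (u ⇒? h)

  Linked : Fin n → Fin n → Set
  Linked u v = Adj G u v ⊎ ∃ λ w → Adj G u w × Adj G w v

  module Bounded {D} (#adj≤D : ∀ v → # (adj? G v) ≤ D) where

    module Family {T : Pred (Fin n) 0ℓ} (T? : Decidable T) where

      Source : Fin n → Set
      Source e = ∀ {x} → T x → ¬ x ⇒ e × (∀ {w} → x ⇒ w → ¬ w ⇒ e)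

      tail? : ∀ h → Decidable (λ v → T v × v ⇒ h)
      tail? h v = T? v ×-dec (v ⇒? h)

      -- The degree of `h` when each member of `T` is viewed as an edge on its out-neighbours.
      d : Fin n → ℕ
      d h = # (tail? h)

      d≤D : ∀ h → d h ≤ D
      d≤D h = ≤-trans (#-mono (tail? h) (adj? G h) λ (_ , vh , _) → adj-sym G vh) (#adj≤D h)

      outs : ∀ v → # (λ h → tail? h v) ≤ ⟦ T? v ⟧ * 2
      outs v = bound (T? v)
        where
        bound : (t : Dec (T v)) → # (λ h → t ×-dec (v ⇒? h)) ≤ ⟦ t ⟧ * 2
        bound (no ¬Tv) = #-∅ (λ h → no ¬Tv ×-dec (v ⇒? h)) λ _ → ¬Tv ∘ proj₁
        bound (yes Tv) = ≤-trans
          (#-mono (λ h → yes Tv ×-dec (v ⇒? h)) (_∈? (p v ∷ q v ∷ []))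
            λ (_ , vh) → [ here , there ∘ here ]′ (out vh))
          (#-∈ (p v ∷ q v ∷ []))

      outs≥2 : ∀ v → (T v → ∃ λ a → ∃ λ b → a ≢ b × v ⇒ a × v ⇒ b) →
        ⟦ T? v ⟧ * 2 ≤ # (λ h → tail? h v)
      outs≥2 v two = bound (T? v)
        where
        bound : (t : Dec (T v)) → ⟦ t ⟧ * 2 ≤ # (λ h → t ×-dec (v ⇒? h))
        bound (no _)   = z≤n
        bound (yes Tv) = let a , b , a≢b , va , vb = two Tv in ≤-trans
          (≤-reflexive (sym (cong₂ _+_ (#-≡ a) (#-≡ b))))
          (#-disjoint (_≟ a) (_≟ b) (λ h → yes Tv ×-dec (v ⇒? h))
            (λ { refl → Tv , va }) (λ { refl → Tv , vb }) λ { refl → a≢b })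

      -- Handshake lemma: the arcs leaving `T`, counted by head and by tail.
      sum-d : sum d ≡ sum λ v → # (λ h → tail? h v)
      sum-d = ∑-comm λ h v → ⟦ tail? h v ⟧

      sum-d≤ : sum d ≤ # T? * 2
      sum-d≤ = ≤-trans (≤-reflexive sum-d)
        (≤-trans (sum-mono outs) (≤-reflexive (sym (*-distribʳ-sum 2 (λ v → ⟦ T? v ⟧)))))

      sum-d≥ : (∀ {v} → T v → ∃ λ a → ∃ λ b → a ≢ b × v ⇒ a × v ⇒ b) → # T? * 2 ≤ sum d
      sum-d≥ two = ≤-trans (≤-reflexive (*-distribʳ-sum 2 (λ v → ⟦ T? v ⟧)))
        (≤-trans (sum-mono λ v → outs≥2 v two) (≤-reflexive (sym sum-d)))

      share? : ∀ e → Decidable (λ u → T u × ShareOut e u)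
      share? e u = T? u ×-dec shareOut? e u

      share≤d+d : ∀ e → # (share? e) ≤ d (p e) + d (q e)
      share≤d+d e = #-∪ (share? e) (tail? (p e)) (tail? (q e))
        λ (Tu , h , eh , uh) → [ (λ { refl → inj₁ (Tu , uh) }) , (λ { refl → inj₂ (Tu , uh) }) ]′ (out eh)

      share≤d : ∀ e a → (∀ {h} → e ⇒ h → h ≡ a) → # (share? e) ≤ d a
      share≤d e a only = #-mono (share? e) (tail? a)
        λ { (Tu , h , eh , uh) → Tu , subst (_ ⇒_) (only eh) uh }

      module _ (linked : ∀ {u v} → T u → T v → u ≢ v → Linked u v) where

        -- For a source, only links through arcs leaving `e`, common in-neighbours and common
        -- out-neighbours remain. The 7 counts `e`, its 2 out-neighbours and their 4; each
        -- in-neighbour of `e` has one other out-neighbour, which gives `D`.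
        coverage : ∀ {e} → T e → Source e → # T? ≤ # (share? e) + (7 + D)
        coverage {e} Te source = ≤-trans
          (#-∪ T? (share? e) rest? cover)
          (+-monoʳ-≤ (# (share? e)) (≤-trans (#-∪ rest? (_∈? near) viaSource? id)
            (+-mono-≤ (#-∈ near) (≤-trans
              (#-⋃ (adj? G e) (λ w → other w ∷ []) (λ _ → ≤-refl))
              (≤-trans (≤-reflexive (*-identityʳ _)) (#adj≤D e))))))
          where
          near : List (Fin n)
          near = e ∷ p e ∷ q e ∷ p (p e) ∷ q (p e) ∷ p (q e) ∷ q (q e) ∷ []

          -- A common in-neighbour w of e and u ≢ e has u as its only other out-neighbour.
          other-by : ∀ w → Dec (p w ≡ e) → Fin n
          other-by w (yes _) = q w
          other-by w (no _)  = p w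

          other : Fin n → Fin n
          other w = other-by w (p w ≟ e)

          viaSource? : Decidable (λ u → ∃ λ w → Adj G e w × u ∈ other w ∷ [])
          viaSource? u = any? λ w → adj? G e w ×-dec (u ∈? (other w ∷ []))

          rest? : Decidable (λ u → u ∈ near ⊎ ∃ λ w → Adj G e w × u ∈ other w ∷ [])
          rest? u = (u ∈? near) ⊎-dec viaSource? u

          other-≡ : ∀ {u w} (pw≟e : Dec (p w ≡ e)) → w ⇒ e → w ⇒ u → u ≢ e →
            u ≡ other-by w pw≟e
          other-≡ (yes pw≡e) _ wu u≢e with out wu
          ... | inj₁ u≡pw = contradiction (trans u≡pw pw≡e) u≢e
          ... | inj₂ u≡qw = u≡qw
          other-≡ (no pw≢e) we wu u≢e with out we | out wu
          ... | inj₁ e≡pw | _         = contradiction (sym e≡pw) pw≢e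
          ... | inj₂ _    | inj₁ u≡pw = u≡pw
          ... | inj₂ e≡qw | inj₂ u≡qw = contradiction (trans u≡qw (sym e≡qw)) u≢e

          secondOut : ∀ {u w} → e ⇒ w → w ⇒ u → u ∈ near
          secondOut ew wu with out ew | out wu
          ... | inj₁ refl | inj₁ refl = there (there (there (here refl)))
          ... | inj₁ refl | inj₂ refl = there (there (there (there (here refl))))
          ... | inj₂ refl | inj₁ refl = there (there (there (there (there (here refl)))))
          ... | inj₂ refl | inj₂ refl = there (there (there (there (there (there (here refl))))))

          cover : ∀ {u} → T u → (T u × ShareOut e u) ⊎
            (u ∈ near ⊎ ∃ λ w → Adj G e w × u ∈ other w ∷ [])
          cover {u} Tu with u ≟ e
          ... | yes u≡e = inj₂ (inj₁ (here u≡e))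
          ... | no u≢e with linked Te Tu (u≢e ∘ sym)
          ...   | inj₁ eu = [ (λ e⇒u → inj₂ (inj₁ ([ there ∘ here , there ∘ there ∘ here ]′ (out e⇒u))))
                            , (λ u⇒e → contradiction u⇒e (proj₁ (source Tu))) ]′ (direct eu)
          ...   | inj₂ (w , ew , wu) with direct ew | direct wu
          ...     | inj₁ e⇒w | inj₁ w⇒u = inj₂ (inj₁ (secondOut e⇒w w⇒u))
          ...     | inj₁ e⇒w | inj₂ u⇒w = inj₁ (Tu , w , e⇒w , u⇒w)
          ...     | inj₂ w⇒e | inj₁ w⇒u = inj₂ (inj₂ (w , ew , here (other-≡ (p w ≟ e) w⇒e w⇒u u≢e)))
          ...     | inj₂ w⇒e | inj₂ u⇒w = contradiction w⇒e (proj₂ (source Tu) u⇒w)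

        -- The multigraph whose edges are the members of `T`

        module Hubs
          (sources : ∀ {e} → T e → Source e)
          (two : ∀ {v} → T v → ∃ λ a → ∃ λ b → a ≢ b × v ⇒ a × v ⇒ b)
          where

          -- `N` is the number of edges. `Q` bounds both the edges disjoint from a given edge, by
          -- `coverage`, and every degree.
          N Q : ℕ
          N = # T?
          Q = 7 + D

          d≤Q : ∀ h → d h ≤ Q
          d≤Q h = ≤-trans (d≤D h) (m≤n+m D 7)

          module Star (u : Fin n) (0<du : 0 < d u) (least : ∀ {w} → 0 < d w → d u ≤ d w) where

            -- The edges joining `u` and `w`. Without `u ≢ w`, the vertex `u` would be its own
            -- neighbour, with multiplicity `d u`; with it, `u` is counted in `l`.
            parallel? : ∀ w → Decidable (λ v → T v × v ⇒ u × v ⇒ w × u ≢ w)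
            parallel? w v = T? v ×-dec ((v ⇒? u) ×-dec ((v ⇒? w) ×-dec ¬? (u ≟ w)))

            μ : Fin n → ℕ
            μ w = # (parallel? w)

            nbr? : Decidable (λ w → 0 < μ w)
            nbr? w = 0 <? μ w

            non? : Decidable (λ w → 0 < d w × ¬ 0 < μ w)
            non? w = (0 <? d w) ×-dec ¬? (0 <? μ w)

            m l : ℕ
            m = # nbr?
            l = # non?

            μ≤d : ∀ w → μ w ≤ d w
            μ≤d w = #-mono (parallel? w) (tail? w) λ (Tv , _ , vw , _) → Tv , vw

            pair : ∀ {e h w} → u ≢ w → e ⇒ u → e ⇒ w → e ⇒ h → h ≡ u ⊎ h ≡ w
            pair u≢w eu ew eh with out eu | out ew | out eh
            ... | inj₁ u≡p | inj₁ w≡p | _        = contradiction (trans u≡p (sym w≡p)) u≢w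
            ... | inj₂ u≡q | inj₂ w≡q | _        = contradiction (trans u≡q (sym w≡q)) u≢w
            ... | inj₁ u≡p | inj₂ w≡q | inj₁ h≡p = inj₁ (trans h≡p (sym u≡p))
            ... | inj₁ u≡p | inj₂ w≡q | inj₂ h≡q = inj₂ (trans h≡q (sym w≡q))
            ... | inj₂ u≡q | inj₁ w≡p | inj₁ h≡p = inj₂ (trans h≡p (sym w≡p))
            ... | inj₂ u≡q | inj₁ w≡p | inj₂ h≡q = inj₁ (trans h≡q (sym u≡q))

            -- Take an edge `e` between `u` and `w`. All but `Q` edges meet it, and those lie in the
            -- star of `u` or of `w`; the `μ w` parallel ones lie in both, hence are counted twice
            -- by `d u + d w`.
            edge : ∀ {w} → 0 < μ w → N + μ w ≤ d u + d w + Q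
            edge {w} 0<μ with 0<#⇒∃ (parallel? w) 0<μ
            ... | e , Te , eu , ew , u≢w = begin
              N + μ w                       ≤⟨ +-monoˡ-≤ (μ w) (coverage Te (sources Te)) ⟩
              # (share? e) + Q + μ w        ≡⟨ eq (# (share? e)) Q (μ w) ⟩
              # (share? e) + μ w + Q        ≤⟨ +-monoˡ-≤ Q both ⟩
              d u + d w + Q                 ∎
              where
              open ≤-Reasoning
              eq : ∀ a b c → a + b + c ≡ a + c + b
              eq = solve-∀
              both : # (share? e) + μ w ≤ d u + d w
              both = #-exchange (share? e) (parallel? w) (tail? u) (tail? w)
                (λ (Tv , h , eh , vh) →
                  [ (λ { refl → inj₁ (Tv , vh) }) , (λ { refl → inj₂ (Tv , vh) }) ]′ (pair u≢w eu ew eh))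
                (λ (Tv , vu , vw , _) → (Tv , vu) , (Tv , vw))

            -- Every edge at `u` has a second end different from `u`, by `two`.
            du≤sum-μ : d u ≤ sum μ
            du≤sum-μ = ≤-trans (sum-mono λ v → ⟦⟧≤ (tail? u v) λ (Tv , vu) → second v Tv vu (two Tv))
              (≤-reflexive (∑-comm λ v w → ⟦ parallel? w v ⟧))
              where
              second : ∀ v → T v → v ⇒ u → (∃ λ a → ∃ λ b → a ≢ b × v ⇒ a × v ⇒ b) →
                1 ≤ # (λ w → parallel? w v)
              second v Tv vu (a , b , a≢b , va , vb) with u ≟ a
              ... | no u≢a   = 0<# (λ w → parallel? w v) (Tv , vu , va , u≢a)
              ... | yes refl = 0<# (λ w → parallel? w v) (Tv , vu , vb , a≢b)

            0<l : 0 < l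
            0<l = 0<# non? (0<du , λ 0<μ → let _ , _ , _ , _ , u≢u = 0<#⇒∃ (parallel? u) 0<μ in u≢u refl)

            -- `u` has a neighbour since its degree is positive; strictness comes from the
            -- multiplicity of that edge.
            low : N < d u + 2 * Q
            low = let w , 0<μ = 0<sum⇒∃ μ (≤-trans 0<du du≤sum-μ) in begin-strict
              N                  <⟨ m<m+n N 0<μ ⟩
              N + μ w            ≤⟨ edge 0<μ ⟩
              d u + d w + Q      ≤⟨ +-monoˡ-≤ Q (+-monoʳ-≤ (d u) (d≤Q w)) ⟩
              d u + Q + Q        ≡⟨ eq (d u) Q ⟩
              d u + 2 * Q        ∎
              where
              open ≤-Reasoning
              eq : ∀ d Q → d + Q + Q ≡ d + 2 * Q
              eq = solve-∀

            sum-weighted : ∀ x y → sum (λ w → ⟦ nbr? w ⟧ * x + ⟦ non? w ⟧ * y) ≡ m * x + l * y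
            sum-weighted x y = trans (∑-distrib-+ (λ w → ⟦ nbr? w ⟧ * x) (λ w → ⟦ non? w ⟧ * y))
              (sym (cong₂ _+_ (*-distribʳ-sum x (λ w → ⟦ nbr? w ⟧)) (*-distribʳ-sum y (λ w → ⟦ non? w ⟧))))

            -- Termwise comparison in sums over all vertices: `w` is a neighbour of `u`, another
            -- vertex of positive degree, or isolated, and the indicators become numerals in each
            -- case.
            byKind : (f : ℕ → ℕ → ℕ → ℕ → Set) → ∀ w →
              (0 < μ w → f 1 0 (μ w) (d w)) → (0 < d w → f 0 1 0 (d w)) → f 0 0 0 0 →
              f ⟦ nbr? w ⟧ ⟦ non? w ⟧ (μ w) (d w)
            byKind f w nbr non none with μ w in μ≡ | d w in d≡
            ... | zero  | zero  = none
            ... | zero  | suc _ = non (s≤s z≤n)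
            ... | suc x | zero  = contradiction (μ≤d w) (<⇒≱ (subst₂ _<_ (sym d≡) (sym μ≡) (s≤s z≤n)))
            ... | suc x | suc _ = nbr (s≤s z≤n)

            nbr-case : ∀ {w} → 0 < μ w → μ w + N ≤ d u + d w + Q
            nbr-case {w} 0<μ = ≤-trans (≤-reflexive (+-comm (μ w) N)) (edge 0<μ)

            -- Sum `edge` over the neighbours of `u` and `d u ≤ d w` over the other vertices of
            -- positive degree. The multiplicities add up to at least `d u`, the degrees to at most
            -- `2 * N`.
            star : (1 + l) * d u + m * N ≤ m * d u + m * Q + 2 * N
            star = begin
              (1 + l) * d u + m * N                    ≡⟨ eq₁ (d u) l (m * N) ⟩
              d u + (m * N + l * d u)                  ≤⟨ +-monoˡ-≤ _ du≤sum-μ ⟩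
              sum μ + (m * N + l * d u)
                ≡⟨ cong (sum μ +_) (sum-weighted N (d u)) ⟨
              sum μ + sum (λ w → ⟦ nbr? w ⟧ * N + ⟦ non? w ⟧ * d u)
                ≡⟨ ∑-distrib-+ μ (λ w → ⟦ nbr? w ⟧ * N + ⟦ non? w ⟧ * d u) ⟨
              sum (λ w → μ w + (⟦ nbr? w ⟧ * N + ⟦ non? w ⟧ * d u))
                ≤⟨ sum-mono (λ w → byKind
                     (λ a b x y → x + (a * N + b * d u) ≤ a * (d u + Q) + y) w
                     (λ 0<μ → ≤-trans (≤-reflexive (eq₂ (μ w) N (d u)))
                        (≤-trans (nbr-case 0<μ) (≤-reflexive (eq₃ (d u) (d w) Q))))
                     (λ 0<d → ≤-trans (≤-reflexive (+-identityʳ (d u))) (least 0<d))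
                     z≤n) ⟩
              sum (λ w → ⟦ nbr? w ⟧ * (d u + Q) + d w)
                ≡⟨ ∑-distrib-+ (λ w → ⟦ nbr? w ⟧ * (d u + Q)) d ⟩
              sum (λ w → ⟦ nbr? w ⟧ * (d u + Q)) + sum d
                ≡⟨ cong (_+ sum d) (*-distribʳ-sum (d u + Q) (λ w → ⟦ nbr? w ⟧)) ⟨
              m * (d u + Q) + sum d                    ≤⟨ +-monoʳ-≤ (m * (d u + Q)) sum-d≤ ⟩
              m * (d u + Q) + N * 2                    ≡⟨ eq₄ m (d u) Q N ⟩
              m * d u + m * Q + 2 * N                  ∎
              where
              open ≤-Reasoning
              eq₁ : ∀ d l x → (1 + l) * d + x ≡ d + (x + l * d)
              eq₁ = solve-∀
              eq₂ : ∀ x N d → x + (1 * N + 0 * d) ≡ x + N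
              eq₂ = solve-∀
              eq₃ : ∀ d y Q → d + y + Q ≡ 1 * (d + Q) + y
              eq₃ = solve-∀
              eq₄ : ∀ m d Q N → m * (d + Q) + N * 2 ≡ m * d + m * Q + 2 * N
              eq₄ = solve-∀

            -- `edge` summed over the neighbours alone, with `d w ≤ Q`; this is sharp enough when
            -- `m` is at most 2.
            few : d u + m * N ≤ m * d u + 2 * (m * Q)
            few = begin
              d u + m * N                              ≤⟨ +-monoˡ-≤ _ du≤sum-μ ⟩
              sum μ + m * N
                ≡⟨ cong (sum μ +_) (*-distribʳ-sum N (λ w → ⟦ nbr? w ⟧)) ⟩
              sum μ + sum (λ w → ⟦ nbr? w ⟧ * N)
                ≡⟨ ∑-distrib-+ μ (λ w → ⟦ nbr? w ⟧ * N) ⟨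
              sum (λ w → μ w + ⟦ nbr? w ⟧ * N)
                ≤⟨ sum-mono (λ w → byKind (λ a _ x _ → x + a * N ≤ a * (d u + 2 * Q)) w
                     (λ 0<μ → ≤-trans (≤-reflexive (cong (μ w +_) (*-identityˡ N))) (≤-trans (nbr-case 0<μ)
                       (≤-trans (+-monoˡ-≤ Q (+-monoʳ-≤ (d u) (d≤Q w))) (≤-reflexive (eq₁ (d u) Q)))))
                     (λ _ → z≤n) z≤n) ⟩
              sum (λ w → ⟦ nbr? w ⟧ * (d u + 2 * Q))
                ≡⟨ *-distribʳ-sum (d u + 2 * Q) (λ w → ⟦ nbr? w ⟧) ⟨
              m * (d u + 2 * Q)                        ≡⟨ eq₂ m (d u) Q ⟩
              m * d u + 2 * (m * Q)                    ∎
              where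
              open ≤-Reasoning
              eq₁ : ∀ d Q → d + Q + Q ≡ 1 * (d + 2 * Q)
              eq₁ = solve-∀
              eq₂ : ∀ m d Q → m * (d + 2 * Q) ≡ m * d + 2 * (m * Q)
              eq₂ = solve-∀

            -- Exactly `m + l` vertices have positive degree, so the handshake lemma compares
            -- `2 * N` with `m + l` times a bound on these degrees.
            weighted-≤ : ∀ {x} → (∀ {w} → 0 < d w → x ≤ d w) → (m + l) * x ≤ 2 * N
            weighted-≤ {x} x≤d = begin
              (m + l) * x         ≡⟨ *-distribʳ-+ x m l ⟩
              m * x + l * x       ≡⟨ sum-weighted x x ⟨
              sum (λ w → ⟦ nbr? w ⟧ * x + ⟦ non? w ⟧ * x)
                ≤⟨ sum-mono (λ w → byKind (λ a b _ y → a * x + b * x ≤ y) w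
                     (λ 0<μ → ≤-trans (≤-reflexive (eq x)) (x≤d (≤-trans 0<μ (μ≤d w))))
                     (λ 0<d → ≤-trans (≤-reflexive (*-identityˡ x)) (x≤d 0<d)) z≤n) ⟩
              sum d               ≤⟨ sum-d≤ ⟩
              N * 2               ≡⟨ *-comm N 2 ⟩
              2 * N               ∎
              where
              open ≤-Reasoning
              eq : ∀ x → 1 * x + 0 * x ≡ x
              eq = solve-∀

            ≤-weighted : 2 * N ≤ (m + l) * Q
            ≤-weighted = begin
              2 * N               ≡⟨ *-comm 2 N ⟩
              N * 2               ≤⟨ sum-d≥ two ⟩
              sum d
                ≤⟨ sum-mono (λ w → byKind (λ a b _ y → y ≤ a * Q + b * Q) w
                     (λ _ → ≤-trans (d≤Q w) (≤-reflexive (eq Q)))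
                     (λ _ → ≤-trans (d≤Q w) (≤-reflexive (sym (*-identityˡ Q)))) z≤n) ⟩
              sum (λ w → ⟦ nbr? w ⟧ * Q + ⟦ non? w ⟧ * Q)
                                  ≡⟨ sum-weighted Q Q ⟩
              m * Q + l * Q       ≡⟨ *-distribʳ-+ Q m l ⟨
              (m + l) * Q         ∎
              where
              open ≤-Reasoning
              eq : ∀ x → x ≡ 1 * x + 0 * x
              eq = solve-∀

            2N≤5Q : 2 * N ≤ 5 * Q
            2N≤5Q = ≮⇒≥ (¬5Q<2N m l 0<du (d≤Q u) low 0<l star (weighted-≤ least) ≤-weighted few)

          2N≤5Q : 2 * N ≤ 5 * Q
          2N≤5Q with any? (λ h → 0 <? d h)
          ... | yes hub = let u , 0<du , least = minimiser (λ h → 0 <? d h) d hub in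
            Star.2N≤5Q u 0<du least
          -- Each member has an out-neighbour, which then has positive degree; so `T` is empty here.
          ... | no none = ≤-trans (*-monoʳ-≤ 2 (#-∅ T? λ v Tv →
            let a , _ , _ , va , _ = two Tv in none (a , 0<# (tail? a) (Tv , va)))) z≤n

-- The bound on the clique

module _ {n} (G : Graph n) (orientation : Orientation G ⊤) {D : ℕ}
  (#adj≤D : ∀ v → # (adj? G v) ≤ D) where
  open Orientation orientation
  open Arcs G orientation
  open Bounded #adj≤D
  open Family using (Source; coverage; share?; share≤d+d; share≤d; tail?; d≤D; d)

  module _ {S : Pred (Fin n) 0ℓ} (S? : Decidable S)
    (linked : ∀ {u v} → S u → S v → u ≢ v → Linked u v) where

    s : ℕ
    s = # S?

    -- Arcs increase the rank, so a member of least rank is a source.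
    s≤3D+7 : s ≤ 3 * D + 7
    s≤3D+7 with any? S?
    ... | no none = ≤-trans (#-∅ S? λ v Sv → none (v , Sv)) z≤n
    ... | yes some = let e , Se , first = minimiser S? rank some in begin
      s                             ≤⟨ coverage S? linked Se (λ Sx →
                                         (λ (_ , x<e) → <⇒≱ x<e (first Sx)) ,
                                         (λ (_ , x<w) (_ , w<e) → <⇒≱ (<-trans x<w w<e) (first Sx))) ⟩
      # (share? S? e) + (7 + D)     ≤⟨ +-monoˡ-≤ (7 + D) (share≤d+d S? e) ⟩
      d S? (p e) + d S? (q e) + (7 + D)
                                    ≤⟨ +-monoˡ-≤ (7 + D) (+-mono-≤ (d≤D S? (p e)) (d≤D S? (q e))) ⟩
      D + D + (7 + D)               ≡⟨ eq D ⟩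
      3 * D + 7                     ∎
      where
      open ≤-Reasoning
      eq : ∀ D → D + D + (7 + D) ≡ 3 * D + 7
      eq = solve-∀

    Big : Fin n → Set
    Big h = D < 2 * d S? h

    big? : Decidable Big
    big? h = D <? 2 * d S? h

    close : Fin n → List (Fin n)
    close h = h ∷ p h ∷ q h ∷ []

    Exceptional : Fin n → Set
    Exceptional v = ∃ λ h → Big h × v ∈ close h

    exceptional? : Decidable Exceptional
    exceptional? v = any? λ h → big? h ×-dec (v ∈? close h)

    T : Fin n → Set
    T v = S v × ¬ Exceptional v

    T? : Decidable T
    T? v = S? v ×-dec ¬? (exceptional? v)

    linkedT : ∀ {u v} → T u → T v → u ≢ v → Linked u v
    linkedT (Su , _) (Sv , _) = linked Su Sv

    -- The arcs are required explicitly because `p v` and `q v` may be mere defaults.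
    Good : Fin n → Set
    Good v = p v ≢ q v × (v ⇒ p v × Big (p v)) × (v ⇒ q v × Big (q v))

    good? : Decidable Good
    good? v = ¬? (p v ≟ q v) ×-dec
      (((v ⇒? p v) ×-dec big? (p v)) ×-dec ((v ⇒? q v) ×-dec big? (q v)))

    good⇒big : ∀ {x w} → Good x → x ⇒ w → Big w
    good⇒big (_ , (_ , bigp) , (_ , bigq)) xw with out xw
    ... | inj₁ refl = bigp
    ... | inj₂ refl = bigq

    -- An arc from a good vertex ends in a big vertex and a path of length 2 in an out-neighbour of
    -- one; both ends are exceptional, hence not `e`. Only vertices of smaller rank can reach `e`,
    -- so goodness is asked of these alone.
    source : ∀ {e} → T e → (∀ {x} → T x → rank x < rank e → Good x) → Source T? e
    source (_ , ordinary) good Tx =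
      (λ xe → ordinary (_ , good⇒big (good Tx (proj₂ xe)) xe , here refl)) ,
      (λ xw we → ordinary (_ , good⇒big (good Tx (<-trans (proj₂ xw) (proj₂ we))) xw ,
        [ there ∘ here , there ∘ there ∘ here ]′ (out we)))

    dT≤dS : ∀ h → d T? h ≤ d S? h
    dT≤dS h = #-mono (tail? T? h) (tail? S? h) λ ((Sv , _) , vh) → Sv , vh

    -- Either `e` has at most one out-neighbour, which gives at most `D`, or one of its two is not
    -- big, which gives at most `D + D/2`.
    bad-share : ∀ {e} → ¬ Good e → 2 * # (share? T? e) ≤ 3 * D
    bad-share {e} bad = bound (p e ≟ q e) (e ⇒? p e) (big? (p e)) (e ⇒? q e) (big? (q e))
      where
      open ≤-Reasoning

      one : ∀ a → (∀ {h} → e ⇒ h → h ≡ a) → 2 * # (share? T? e) ≤ 3 * D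
      one a only = *-mono-≤ (n≤1+n 2) (≤-trans (share≤d T? e a only) (d≤D T? a))

      small : ∀ {x y} → x ≤ D → 2 * y ≤ D → 2 * (x + y) ≤ 3 * D
      small {x} {y} x≤D 2y≤D = begin
        2 * (x + y)      ≡⟨ *-distribˡ-+ 2 x y ⟩
        2 * x + 2 * y    ≤⟨ +-mono-≤ (*-monoʳ-≤ 2 x≤D) 2y≤D ⟩
        2 * D + D        ≡⟨ +-comm (2 * D) D ⟩
        3 * D            ∎

      2dT≤D : ∀ {h} → ¬ Big h → 2 * d T? h ≤ D
      2dT≤D {h} ¬big = ≤-trans (*-monoʳ-≤ 2 (dT≤dS h)) (≮⇒≥ ¬big)

      bound : Dec (p e ≡ q e) → Dec (e ⇒ p e) → Dec (Big (p e)) →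
        Dec (e ⇒ q e) → Dec (Big (q e)) → 2 * # (share? T? e) ≤ 3 * D
      bound (yes p≡q) _ _ _ _ = one (p e) λ eh → [ id , (λ h≡q → trans h≡q (sym p≡q)) ]′ (out eh)
      bound _ (no ¬ep) _ _ _ = one (q e) λ eh → [ (λ { refl → contradiction eh ¬ep }) , id ]′ (out eh)
      bound _ _ _ (no ¬eq) _ = one (p e) λ eh → [ id , (λ { refl → contradiction eh ¬eq }) ]′ (out eh)
      bound _ _ (no ¬big) _ _ = ≤-trans (*-monoʳ-≤ 2 (≤-trans (share≤d+d T? e)
        (≤-reflexive (+-comm (d T? (p e)) (d T? (q e)))))) (small (d≤D T? (q e)) (2dT≤D ¬big))
      bound _ _ _ _ (no ¬big) = ≤-trans (*-monoʳ-≤ 2 (share≤d+d T? e))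
        (small (d≤D T? (p e)) (2dT≤D ¬big))
      bound (no p≢q) (yes ep) (yes bigp) (yes eq) (yes bigq) =
        contradiction (p≢q , (ep , bigp) , (eq , bigq)) bad

    2#T≤ : 2 * # T? ≤ 5 * (7 + D)
    2#T≤ with any? (λ v → T? v ×-dec ¬? (good? v))
    -- Below a member of least rank that is not good, all of `T` is good, as `source` requires.
    ... | yes bad = let e , (Te , ¬good) , first = minimiser (λ v → T? v ×-dec ¬? (good? v)) rank bad in begin
      2 * # T?                              ≤⟨ *-monoʳ-≤ 2 (coverage T? linkedT Te (source Te λ {x} Tx x<e →
                                                 decidable-stable (good? x) λ ¬good →
                                                   <⇒≱ x<e (first (Tx , ¬good)))) ⟩
      2 * (# (share? T? e) + (7 + D))       ≡⟨ *-distribˡ-+ 2 (# (share? T? e)) (7 + D) ⟩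
      2 * # (share? T? e) + 2 * (7 + D)     ≤⟨ +-monoˡ-≤ (2 * (7 + D)) (bad-share ¬good) ⟩
      3 * D + 2 * (7 + D)                   ≤⟨ +-monoˡ-≤ (2 * (7 + D)) (*-monoʳ-≤ 3 (m≤n+m D 7)) ⟩
      3 * (7 + D) + 2 * (7 + D)             ≡⟨ *-distribʳ-+ (7 + D) 3 2 ⟨
      5 * (7 + D)                           ∎
      where open ≤-Reasoning
    ... | no ∄bad = Family.Hubs.2N≤5Q T? linkedT (λ Te → source Te λ Tx _ → good Tx)
      λ Tv → let p≢q , (vp , _) , (vq , _) = good Tv in _ , _ , p≢q , vp , vq
      where
      good : ∀ {v} → T v → Good v
      good {v} Tv = decidable-stable (good? v) λ ¬good → ∄bad (v , Tv , ¬good)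

    -- The degrees add up to at most `2 * s`, and a big vertex has twice its degree at least
    -- `1 + D`.
    #big : # big? * (1 + D) ≤ 4 * s
    #big = begin
      # big? * (1 + D)                      ≡⟨ *-distribʳ-sum (1 + D) (λ h → ⟦ big? h ⟧) ⟩
      sum (λ h → ⟦ big? h ⟧ * (1 + D))      ≤⟨ sum-mono (λ h → weight h (big? h)) ⟩
      sum (λ h → 2 * d S? h)                ≡⟨ *-distribˡ-sum 2 (d S?) ⟨
      2 * sum (d S?)                        ≤⟨ *-monoʳ-≤ 2 (Family.sum-d≤ S?) ⟩
      2 * (s * 2)                           ≡⟨ eq s ⟩
      4 * s                                 ∎
      where
      open ≤-Reasoning
      weight : ∀ h (b : Dec (Big h)) → ⟦ b ⟧ * (1 + D) ≤ 2 * d S? h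
      weight h (yes big) = ≤-trans (≤-reflexive (*-identityˡ (1 + D))) big
      weight h (no _)    = z≤n
      eq : ∀ s → 2 * (s * 2) ≡ 4 * s
      eq = solve-∀

    -- Thirteen big vertices would need `13 * (1 + D) ≤ 4 * (3 * D + 7)`, that is `D ≤ 15`.
    #big≤12 : 16 ≤ D → # big? ≤ 12
    #big≤12 16≤D = ≮⇒≥ λ 12<# → <⇒≱ (begin-strict
      4 * s                   ≤⟨ *-monoʳ-≤ 4 s≤3D+7 ⟩
      4 * (3 * D + 7)         ≡⟨ eq D ⟩
      12 * D + 28             <⟨ +-monoʳ-< (12 * D) (+-monoʳ-≤ 13 16≤D) ⟩
      12 * D + (13 + D)       ≡⟨ eq′ D ⟩
      13 * (1 + D)            ≤⟨ *-monoˡ-≤ (1 + D) 12<# ⟩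
      # big? * (1 + D)        ∎) #big
      where
      open ≤-Reasoning
      eq : ∀ D → 4 * (3 * D + 7) ≡ 12 * D + 28
      eq = solve-∀
      eq′ : ∀ D → 12 * D + (13 + D) ≡ 13 * (1 + D)
      eq′ = solve-∀

    s≤#T+ : s ≤ # T? + # big? * 3
    s≤#T+ = ≤-trans (#-∪ S? T? exceptional? split)
      (+-monoʳ-≤ (# T?) (#-⋃ big? close λ _ → ≤-refl))
      where
      split : ∀ {v} → S v → T v ⊎ Exceptional v
      split {v} Sv with exceptional? v
      ... | yes ex = inj₂ ex
      ... | no ¬ex = inj₁ (Sv , ¬ex)

    -- For `D ≥ 16`, at most 12 big vertices with 3 exceptional vertices each remove 36 members, and
    -- `35 + 72 = 107`. For smaller `D` the bound `3 * D + 7` suffices.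
    2s≤5D+120 : 2 * s ≤ 5 * D + 120
    2s≤5D+120 with 16 ≤? D
    ... | yes 16≤D = begin
      2 * s                            ≤⟨ *-monoʳ-≤ 2 (≤-trans s≤#T+ (+-monoʳ-≤ (# T?) (*-monoˡ-≤ 3 (#big≤12 16≤D)))) ⟩
      2 * (# T? + 36)                  ≡⟨ *-distribˡ-+ 2 (# T?) 36 ⟩
      2 * # T? + 72                    ≤⟨ +-monoˡ-≤ 72 2#T≤ ⟩
      5 * (7 + D) + 72                 ≡⟨ eq D ⟩
      5 * D + 107                      ≤⟨ +-monoʳ-≤ (5 * D) (m≤m+n 107 13) ⟩
      5 * D + 120                      ∎
      where
      open ≤-Reasoning
      eq : ∀ D → 5 * (7 + D) + 72 ≡ 5 * D + 107
      eq = solve-∀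
    ... | no 16≰D = begin
      2 * s                            ≤⟨ *-monoʳ-≤ 2 s≤3D+7 ⟩
      2 * (3 * D + 7)                  ≡⟨ eq D ⟩
      5 * D + (14 + D)                 ≤⟨ +-monoʳ-≤ (5 * D) (+-monoʳ-≤ 14 (<⇒≤ (≰⇒> 16≰D))) ⟩
      5 * D + 30                       ≤⟨ +-monoʳ-≤ (5 * D) (m≤m+n 30 90) ⟩
      5 * D + 120                      ∎
      where
      open ≤-Reasoning
      eq : ∀ D → 2 * (3 * D + 7) ≡ 5 * D + (14 + D)
      eq = solve-∀

-- From cliques to `ω`, and from naturals to rationals

#adj≤Δ : ∀ {n} (G : Graph n) v → # (adj? G v) ≤ Δ G
#adj≤Δ {n} G v = subst (_≤ Δ G) (∣tabulate∣ (adj? G v))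
  (All.lookup (xs≤max 0 (map (degree G) (allFin n))) (∈-map⁺ (degree G) (∈-allFin v)))

2ω≤5D+120 : ∀ {n D} (G : Graph n) → Degenerate 2 G → Δ G ≤ D → 2 * ω (G ²) ≤ 5 * D + 120
2ω≤5D+120 {n} {D} G degenerate Δ≤D =
  -- A maximum with default 0: the bound is checked at 0, by `z≤n`, and at the size of every clique.
  argmax-all id {P = λ k → 2 * k ≤ 5 * D + 120} z≤n
    (All-map⁺ (All.map clique-bound (all-filter (clique? (G ²)) (subsets n))))
  where
  clique-bound : ∀ {S} → Clique (G ²) S → 2 * ∣ S ∣ ≤ 5 * D + 120
  clique-bound {S} clique = subst (λ k → 2 * k ≤ 5 * D + 120) (sym (∣S∣≡# S))
    (2s≤5D+120 G o (λ v → ≤-trans (#adj≤Δ G v) Δ≤D) (_∈ₛ? S) linked)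
    where
    o = orientation G degenerate ⊤ (<-wellFounded _)
    linked : ∀ {u v} → u ∈ₛ S → v ∈ₛ S → u ≢ v → Arcs.Linked G o u v
    linked {u} {v} u∈S v∈S u≢v with clique u v u∈S v∈S u≢v
    ... | inj₁ uv = inj₁ uv
    ... | inj₂ ((w , uw , _ , wv , refl) , _) = inj₂ (w , uw , wv)

open import Data.Integer.Base using (+_; +≤+)

-- In unnormalised rationals the inequality is a cross-multiplication of integers; the homomorphism
-- laws of `toℚᵘ` carry it back.
≤-rational : ∀ c k D → 2 * k ≤ 5 * D + 2 * c →
  + k / 1 ℚ.≤ (+ 5 / 2) ℚ.* (+ D / 1) ℚ.+ (+ c / 1)
≤-rational c k D bound = ℚ.toℚᵘ-cancel-≤ (begin
  ℚ.toℚᵘ (+ k / 1)                                     ≃⟨ ℚ.toℚᵘ-fromℚᵘ (ℚᵘ.mkℚᵘ (+ k) 0) ⟩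
  ℚᵘ.mkℚᵘ (+ k) 0                                      ≤⟨ ℚᵘ.*≤* (subst₂ ℤ._≤_ (ℤ.pos-* k 2) rhs (+≤+ bound′)) ⟩
  ℚᵘ.mkℚᵘ (+ 5) 1 ℚᵘ.* ℚᵘ.mkℚᵘ (+ D) 0 ℚᵘ.+ ℚᵘ.mkℚᵘ (+ c) 0
    ≃⟨ ℚᵘ.+-cong (ℚᵘ.*-cong (ℚ.toℚᵘ-fromℚᵘ (ℚᵘ.mkℚᵘ (+ 5) 1)) (ℚ.toℚᵘ-fromℚᵘ (ℚᵘ.mkℚᵘ (+ D) 0))) (ℚ.toℚᵘ-fromℚᵘ (ℚᵘ.mkℚᵘ (+ c) 0)) ⟨
  ℚ.toℚᵘ (+ 5 / 2) ℚᵘ.* ℚ.toℚᵘ (+ D / 1) ℚᵘ.+ ℚ.toℚᵘ (+ c / 1)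
    ≃⟨ ℚᵘ.+-congˡ (ℚ.toℚᵘ (+ c / 1)) (ℚ.toℚᵘ-homo-* (+ 5 / 2) (+ D / 1)) ⟨
  ℚ.toℚᵘ ((+ 5 / 2) ℚ.* (+ D / 1)) ℚᵘ.+ ℚ.toℚᵘ (+ c / 1)
    ≃⟨ ℚ.toℚᵘ-homo-+ ((+ 5 / 2) ℚ.* (+ D / 1)) (+ c / 1) ⟨
  ℚ.toℚᵘ ((+ 5 / 2) ℚ.* (+ D / 1) ℚ.+ (+ c / 1)) ∎)
  where
  open ℚᵘ.≤-Reasoning

  -- The shape in which cross-multiplying with denominators 1 and 2 leaves the two sides.
  bound′ : k * 2 ≤ (5 * D * 1 + c * 2) * 1
  bound′ = subst₂ _≤_ (*-comm 2 k) (eq c D) bound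
    where
    eq : ∀ c D → 5 * D + 2 * c ≡ (5 * D * 1 + c * 2) * 1
    eq = solve-∀

  rhs : + ((5 * D * 1 + c * 2) * 1) ≡ (+ 5 ℤ.* + D ℤ.* + 1 ℤ.+ + c ℤ.* + 2) ℤ.* + 1
  rhs = trans (ℤ.pos-* (5 * D * 1 + c * 2) 1) (cong (ℤ._* + 1)
    (trans (ℤ.pos-+ (5 * D * 1) (c * 2)) (cong₂ ℤ._+_
      (trans (ℤ.pos-* (5 * D) 1) (cong (ℤ._* + 1) (ℤ.pos-* 5 D))) (ℤ.pos-* c 2))))

theorem1 : (D : ℕ) → .{{_ : NonZero D}} →
    {n : ℕ} (G : Graph n) → Degenerate 2 G → Δ G ℕ.≤ D →
    (+ ω (G ²) / 1 ℚ.≤ (+ 5 / 2) ℚ.* (+ D / 1) ℚ.+ (+ 72 / 1))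
    × (1729 ℕ.≤ D → + ω (G ²) / 1 ℚ.≤ (+ 5 / 2) ℚ.* (+ D / 1) ℚ.+ (+ 60 / 1))
theorem1 D G degenerate Δ≤D =
  -- `120 + 24 = 2 * 72`, and `120 = 2 * 60` below.
  ≤-rational 72 (ω (G ²)) D (≤-trans bound (+-monoʳ-≤ (5 * D) (m≤m+n 120 24))) ,
  (λ _ → ≤-rational 60 (ω (G ²)) D bound)
  where
  bound : 2 * ω (G ²) ≤ 5 * D + 120
  bound = 2ω≤5D+120 G degenerate Δ≤D
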